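{- Let $(G_m)_{m\in\mathbb{Z}}$ be a generalized Fibonacci sequence and let $n\ge 0$ be an integer. Then $$\sum_{k=0}^n (-1)^k G_k G_{n-k} = - \frac{1}{2} \left(1+(-1)^n\right) \left( G_{ -1} G_n - G_0 G_{n+1} \right).$$
   Context: A generalized Fibonacci sequence is a sequence $(G_m)_{m\in\mathbb{Z}}$ of complex numbers with $G_{m+2}=G_{m+1}+G_m$ for all integers $m$ (with arbitrary seed $G_0,G_1$); in particular $G_{ -1}=G_1-G_0$. -}

module Defs where

open import Algebra.Bundles using (CommutativeRing)
import Algebra.Consequences.Setoid as Consequences
import Algebra.Properties.Semiring.Exp as SemiringExp
import Algebra.Properties.Semiring.Sum as SemiringSum
open import Data.Integer.Base as ℤ using (ℤ)
open import Data.Nat.Base as ℕ using (ℕ; _⊔_)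
import Data.Nat.Properties as ℕₚ
open import Data.Product.Base using (_×_; _,_; ∃-syntax)
open import Data.Rational.Base as ℚ using (ℚ; 0ℚ; 1ℚ; ∣_∣)
import Data.Rational.Properties as ℚₚ
open import Level using (0ℓ)
open import Relation.Binary.Bundles using (Setoid)
open import Relation.Binary.Structures using (IsEquivalence)
open import Relation.Binary.PropositionalEquality
  using (_≡_; refl; sym; trans; cong; subst)
open import Relation.Nullary.Decidable using (dec⇒maybe)
open import Tactic.RingSolver using (solve-∀)
open import Tactic.RingSolver.Core.AlmostCommutativeRing
  using (AlmostCommutativeRing; fromCommutativeRing)

-- The real numbers: Cauchy sequences of rationals, up to the setoid equality
-- _≃_ that identifies two sequences when their difference tends to 0.

record ℝ : Set where
  no-eta-equality  -- otherwise conversion checking unfolds the Cauchy proofs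
  constructor mkℝ
  field
    seq    : ℕ → ℚ
    cauchy : ∀ ε → 0ℚ ℚ.< ε →
             ∃[ N ] (∀ m n → N ℕ.≤ m → N ℕ.≤ n → ∣ seq m ℚ.- seq n ∣ ℚ.< ε)

open ℝ

infix 4 _≃_

record _≃_ (x y : ℝ) : Set where
  constructor mk≃
  field
    close : ∀ ε → 0ℚ ℚ.< ε →
            ∃[ N ] (∀ n → N ℕ.≤ n → ∣ seq x n ℚ.- seq y n ∣ ℚ.< ε)

open _≃_

private
  ℚ-ring : AlmostCommutativeRing 0ℓ 0ℓ
  ℚ-ring = fromCommutativeRing ℚₚ.+-*-commutativeRing (λ q → dec⇒maybe (0ℚ ℚₚ.≟ q))

  half : ∀ ε → 0ℚ ℚ.< ε → ∃[ δ ] (0ℚ ℚ.< δ × δ ℚ.+ δ ≡ ε)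
  half ε 0<ε = ℚ.½ ℚ.* ε , 0<δ , δ+δ≡ε
    where
    0<δ : 0ℚ ℚ.< ℚ.½ ℚ.* ε
    0<δ = ℚₚ.positive⁻¹ _
      {{ℚₚ.pos*pos⇒pos ℚ.½ ε {{ℚ.positive 0<ε}}}}
    δ+δ≡ε : ℚ.½ ℚ.* ε ℚ.+ ℚ.½ ℚ.* ε ≡ ε
    δ+δ≡ε = trans (sym (ℚₚ.*-distribʳ-+ ε ℚ.½ ℚ.½)) (ℚₚ.*-identityˡ ε)

  quotient : ∀ A ε → 0ℚ ℚ.< A → 0ℚ ℚ.< ε → ∃[ δ ] (0ℚ ℚ.< δ × A ℚ.* δ ≡ ε)
  quotient A ε 0<A 0<ε = A⁻¹ ℚ.* ε , 0<δ , Aδ≡ε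
    where
    instance
      A-pos : ℚ.Positive A
      A-pos = ℚ.positive 0<A
      A-nonZero : ℚ.NonZero A
      A-nonZero = ℚₚ.pos⇒nonZero A
    A⁻¹ : ℚ
    A⁻¹ = ℚ.1/ A
    0<δ : 0ℚ ℚ.< A⁻¹ ℚ.* ε
    0<δ = ℚₚ.positive⁻¹ _
      {{ℚₚ.pos*pos⇒pos A⁻¹ {{ℚₚ.1/pos⇒pos A}} ε {{ℚ.positive 0<ε}}}}
    Aδ≡ε : A ℚ.* (A⁻¹ ℚ.* ε) ≡ ε
    Aδ≡ε = trans (sym (ℚₚ.*-assoc A A⁻¹ ε))
      (trans (cong (ℚ._* ε) (ℚₚ.*-inverseʳ A)) (ℚₚ.*-identityˡ ε))

  sum-close : ∀ {a b δ η ε} → ∣ a ∣ ℚ.< δ → ∣ b ∣ ℚ.< η → δ ℚ.+ η ≡ ε →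
              ∀ {c} → a ℚ.+ b ≡ c → ∣ c ∣ ℚ.< ε
  sum-close {a} {b} a<δ b<η refl refl =
    ℚₚ.≤-<-trans (ℚₚ.∣p+q∣≤∣p∣+∣q∣ a b) (ℚₚ.+-mono-< a<δ b<η)

  prod-close : ∀ {a b A δ ε} → ∣ a ∣ ℚ.< A → ∣ b ∣ ℚ.< δ → 0ℚ ℚ.< δ →
               A ℚ.* δ ≡ ε → ∣ a ℚ.* b ∣ ℚ.< ε
  prod-close {a} {b} {A} {δ} a<A b<δ 0<δ refl =
    subst (ℚ._< A ℚ.* δ) (sym (ℚₚ.∣p*q∣≡∣p∣*∣q∣ a b))
      (ℚₚ.≤-<-trans
        (ℚₚ.*-monoˡ-≤-nonNeg ∣ a ∣ {{ℚ.nonNegative (ℚₚ.0≤∣p∣ a)}} (ℚₚ.<⇒≤ b<δ))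
        (ℚₚ.*-monoˡ-<-pos δ {{ℚ.positive 0<δ}} a<A))

  flip-close : ∀ a b {ε} → ∣ a ℚ.- b ∣ ℚ.< ε → ∣ b ℚ.- a ∣ ℚ.< ε
  flip-close a b = subst (ℚ._< _) (trans (sym (ℚₚ.∣-p∣≡∣p∣ _)) (cong ∣_∣ (lemma a b)))
    where
    lemma : ∀ a b → ℚ.- (a ℚ.- b) ≡ b ℚ.- a
    lemma = solve-∀ ℚ-ring

  sub-telescope : ∀ a b c → (a ℚ.- b) ℚ.+ (b ℚ.- c) ≡ a ℚ.- c
  sub-telescope = solve-∀ ℚ-ring

  sub-+ : ∀ a b c d → (a ℚ.- c) ℚ.+ (b ℚ.- d) ≡ (a ℚ.+ b) ℚ.- (c ℚ.+ d)
  sub-+ = solve-∀ ℚ-ring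

  sub-neg : ∀ a b → b ℚ.- a ≡ ℚ.- a ℚ.- ℚ.- b
  sub-neg = solve-∀ ℚ-ring

  sub-* : ∀ a b c d → a ℚ.* (b ℚ.- d) ℚ.+ d ℚ.* (a ℚ.- c) ≡ a ℚ.* b ℚ.- c ℚ.* d
  sub-* = solve-∀ ℚ-ring

  sub-add : ∀ a b → (a ℚ.- b) ℚ.+ b ≡ a
  sub-add = solve-∀ ℚ-ring

  bounded : ∀ x → ∃[ A ] (0ℚ ℚ.< A × ∃[ N ] (∀ n → N ℕ.≤ n → ∣ seq x n ∣ ℚ.< A))
  bounded x with cauchy x 1ℚ (ℚₚ.positive⁻¹ 1ℚ)
  ... | N , near = 1ℚ ℚ.+ ∣ seq x N ∣ , 0<A , N , λ n N≤n →
      subst (λ a → ∣ a ∣ ℚ.< _) (sub-add (seq x n) (seq x N))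
        (ℚₚ.≤-<-trans (ℚₚ.∣p+q∣≤∣p∣+∣q∣ (seq x n ℚ.- seq x N) (seq x N))
          (ℚₚ.+-mono-<-≤ (near n N N≤n ℕₚ.≤-refl) ℚₚ.≤-refl))
    where
    0<A : 0ℚ ℚ.< 1ℚ ℚ.+ ∣ seq x N ∣
    0<A = ℚₚ.+-mono-<-≤ (ℚₚ.positive⁻¹ 1ℚ) (ℚₚ.0≤∣p∣ (seq x N))

  ⊔ˡ : ∀ M N {n} → M ⊔ N ℕ.≤ n → M ℕ.≤ n
  ⊔ˡ M N = ℕₚ.≤-trans (ℕₚ.m≤m⊔n M N)

  ⊔ʳ : ∀ M N {n} → M ⊔ N ℕ.≤ n → N ℕ.≤ n
  ⊔ʳ M N = ℕₚ.≤-trans (ℕₚ.m≤n⊔m M N)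

pointwise : ∀ {x y} → (∀ n → seq x n ≡ seq y n) → x ≃ y
pointwise {x} {y} eq = mk≃ λ ε 0<ε → 0 , λ n _ →
  subst (ℚ._< ε) (cong ∣_∣ (sym (trans (cong (ℚ._- seq y n) (eq n))
                                         (ℚₚ.+-inverseʳ (seq y n))))) 0<ε

fromℚ : ℚ → ℝ
fromℚ q = mkℝ (λ _ → q) λ ε 0<ε → 0 , λ _ _ _ _ →
  subst (ℚ._< ε) (cong ∣_∣ (sym (ℚₚ.+-inverseʳ q))) 0<ε

infixl 6 _+ᴿ_
infixl 7 _*ᴿ_
infix  8 -ᴿ_

_+ᴿ_ : ℝ → ℝ → ℝ
seq    (x +ᴿ y) n = seq x n ℚ.+ seq y n
cauchy (x +ᴿ y) ε 0<ε =
  let δ , 0<δ , δ+δ≡ε = half ε 0<ε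
      M , p = cauchy x δ 0<δ
      N , q = cauchy y δ 0<δ in
  M ⊔ N , λ m n ≤m ≤n → sum-close (p m n (⊔ˡ M N ≤m) (⊔ˡ M N ≤n)) (q m n (⊔ʳ M N ≤m) (⊔ʳ M N ≤n)) δ+δ≡ε
    (sub-+ (seq x m) (seq y m) (seq x n) (seq y n))

-ᴿ_ : ℝ → ℝ
seq    (-ᴿ x) n = ℚ.- seq x n
cauchy (-ᴿ x) ε 0<ε = let N , p = cauchy x ε 0<ε in
  N , λ m n N≤m N≤n →
  subst (λ a → ∣ a ∣ ℚ.< ε) (sub-neg (seq x m) (seq x n)) (p n m N≤n N≤m)

_*ᴿ_ : ℝ → ℝ → ℝ
seq    (x *ᴿ y) n = seq x n ℚ.* seq y n
cauchy (x *ᴿ y) ε 0<ε =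
  let γ , 0<γ , γ+γ≡ε = half ε 0<ε
      A , 0<A , K , x<A = bounded x
      B , 0<B , L , y<B = bounded y
      δ , 0<δ , Aδ≡γ = quotient A γ 0<A 0<γ
      η , 0<η , Bη≡γ = quotient B γ 0<B 0<γ
      M , q = cauchy y δ 0<δ
      N , p = cauchy x η 0<η in
  (K ⊔ L) ⊔ (M ⊔ N) , λ m n ≤m ≤n →
  let ≤m₁ = ⊔ˡ (K ⊔ L) (M ⊔ N) ≤m ; ≤m₂ = ⊔ʳ (K ⊔ L) (M ⊔ N) ≤m
      ≤n₁ = ⊔ˡ (K ⊔ L) (M ⊔ N) ≤n ; ≤n₂ = ⊔ʳ (K ⊔ L) (M ⊔ N) ≤n in
  sum-close
    (prod-close (x<A m (⊔ˡ K L ≤m₁)) (q m n (⊔ˡ M N ≤m₂) (⊔ˡ M N ≤n₂)) 0<δ Aδ≡γ)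
    (prod-close (y<B n (⊔ʳ K L ≤n₁)) (p m n (⊔ʳ M N ≤m₂) (⊔ʳ M N ≤n₂)) 0<η Bη≡γ)
    γ+γ≡ε
    (sub-* (seq x m) (seq y m) (seq x n) (seq y n))

private
  ≃-refl : ∀ {x} → x ≃ x
  ≃-refl = pointwise λ _ → refl

  ≃-sym : ∀ {x y} → x ≃ y → y ≃ x
  ≃-sym {x} {y} x≃y = mk≃ λ ε 0<ε → let N , p = close x≃y ε 0<ε in
    N , λ n N≤n → flip-close (seq x n) (seq y n) (p n N≤n)

  ≃-trans : ∀ {x y z} → x ≃ y → y ≃ z → x ≃ z
  ≃-trans {x} {y} {z} x≃y y≃z = mk≃ λ ε 0<ε →
    let δ , 0<δ , δ+δ≡ε = half ε 0<ε
        M , p = close x≃y δ 0<δ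
        N , q = close y≃z δ 0<δ in
    M ⊔ N , λ n ≤n → sum-close (p n (⊔ˡ M N ≤n)) (q n (⊔ʳ M N ≤n)) δ+δ≡ε
      (sub-telescope (seq x n) (seq y n) (seq z n))

  +ᴿ-cong : ∀ {x x′ y y′} → x ≃ x′ → y ≃ y′ → x +ᴿ y ≃ x′ +ᴿ y′
  +ᴿ-cong {x} {x′} {y} {y′} x≃ y≃ = mk≃ λ ε 0<ε →
    let δ , 0<δ , δ+δ≡ε = half ε 0<ε
        M , p = close x≃ δ 0<δ
        N , q = close y≃ δ 0<δ in
    M ⊔ N , λ n ≤n → sum-close (p n (⊔ˡ M N ≤n)) (q n (⊔ʳ M N ≤n)) δ+δ≡ε
      (sub-+ (seq x n) (seq y n) (seq x′ n) (seq y′ n))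

  -ᴿ-cong : ∀ {x x′} → x ≃ x′ → -ᴿ x ≃ -ᴿ x′
  -ᴿ-cong {x} {x′} x≃ = mk≃ λ ε 0<ε → let N , p = close x≃ ε 0<ε in
    N , λ n N≤n → subst (λ a → ∣ a ∣ ℚ.< ε) (sub-neg (seq x n) (seq x′ n))
      (flip-close (seq x n) (seq x′ n) (p n N≤n))

  *ᴿ-cong : ∀ {x x′ y y′} → x ≃ x′ → y ≃ y′ → x *ᴿ y ≃ x′ *ᴿ y′
  *ᴿ-cong {x} {x′} {y} {y′} x≃ y≃ = mk≃ λ ε 0<ε →
    let γ , 0<γ , γ+γ≡ε = half ε 0<ε
        A , 0<A , K , x<A = bounded x
        B , 0<B , L , y<B = bounded y′
        δ , 0<δ , Aδ≡γ = quotient A γ 0<A 0<γ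
        η , 0<η , Bη≡γ = quotient B γ 0<B 0<γ
        M , q = close y≃ δ 0<δ
        N , p = close x≃ η 0<η in
    (K ⊔ L) ⊔ (M ⊔ N) , λ n ≤n →
      let ≤n₁ = ⊔ˡ (K ⊔ L) (M ⊔ N) ≤n ; ≤n₂ = ⊔ʳ (K ⊔ L) (M ⊔ N) ≤n in
      sum-close
        (prod-close (x<A n (⊔ˡ K L ≤n₁)) (q n (⊔ˡ M N ≤n₂)) 0<δ Aδ≡γ)
        (prod-close (y<B n (⊔ʳ K L ≤n₁)) (p n (⊔ʳ M N ≤n₂)) 0<η Bη≡γ)
        γ+γ≡ε
        (sub-* (seq x n) (seq y n) (seq x′ n) (seq y′ n))

ℝ-commutativeRing : CommutativeRing 0ℓ 0ℓ
ℝ-commutativeRing = record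
  { Carrier = ℝ
  ; _≈_ = _≃_
  ; _+_ = _+ᴿ_
  ; _*_ = _*ᴿ_
  ; -_  = -ᴿ_
  ; 0#  = fromℚ 0ℚ
  ; 1#  = fromℚ 1ℚ
  ; isCommutativeRing = record
    { isRing = record
      { +-isAbelianGroup = record
        { isGroup = record
          { isMonoid = record
            { isSemigroup = record
              { isMagma = record
                { isEquivalence = record
                  { refl = ≃-refl ; sym = ≃-sym ; trans = ≃-trans }
                ; ∙-cong = +ᴿ-cong
                }
              ; assoc = λ x y z → pointwise λ n →
                  ℚₚ.+-assoc (seq x n) (seq y n) (seq z n)
              }
            ; identity = (λ x → pointwise λ n → ℚₚ.+-identityˡ (seq x n))
                       , (λ x → pointwise λ n → ℚₚ.+-identityʳ (seq x n))
            }
          ; inverse = (λ x → pointwise λ n → ℚₚ.+-inverseˡ (seq x n))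
                    , (λ x → pointwise λ n → ℚₚ.+-inverseʳ (seq x n))
          ; ⁻¹-cong = -ᴿ-cong
          }
        ; comm = λ x y → pointwise λ n → ℚₚ.+-comm (seq x n) (seq y n)
        }
      ; *-cong = *ᴿ-cong
      ; *-assoc = λ x y z → pointwise λ n →
          ℚₚ.*-assoc (seq x n) (seq y n) (seq z n)
      ; *-identity = (λ x → pointwise λ n → ℚₚ.*-identityˡ (seq x n))
                   , (λ x → pointwise λ n → ℚₚ.*-identityʳ (seq x n))
      ; distrib = (λ x y z → pointwise λ n →
                    ℚₚ.*-distribˡ-+ (seq x n) (seq y n) (seq z n))
                , (λ x y z → pointwise λ n →
                    ℚₚ.*-distribʳ-+ (seq x n) (seq y n) (seq z n))
      }
    ; *-comm = λ x y → pointwise λ n → ℚₚ.*-comm (seq x n) (seq y n)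
    }
  }

record ℂ : Set where
  constructor _+i_
  field
    re im : ℝ

infix 4 _≃ᶜ_

record _≃ᶜ_ (z w : ℂ) : Set where
  constructor mk≃ᶜ
  field
    re-≃ : ℂ.re z ≃ ℂ.re w
    im-≃ : ℂ.im z ≃ ℂ.im w

infixl 6 _+ᶜ_
infixl 7 _*ᶜ_
infix  8 -ᶜ_

_+ᶜ_ : ℂ → ℂ → ℂ
(a +i b) +ᶜ (c +i d) = (a +ᴿ c) +i (b +ᴿ d)

_*ᶜ_ : ℂ → ℂ → ℂ
(a +i b) *ᶜ (c +i d) = (a *ᴿ c +ᴿ -ᴿ (b *ᴿ d)) +i (a *ᴿ d +ᴿ b *ᴿ c)

-ᶜ_ : ℂ → ℂ
-ᶜ (a +i b) = (-ᴿ a) +i (-ᴿ b)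

private
  module R = CommutativeRing ℝ-commutativeRing

  assoc-re : ∀ a b c d e f →
    (a ℚ.* c ℚ.- b ℚ.* d) ℚ.* e ℚ.- (a ℚ.* d ℚ.+ b ℚ.* c) ℚ.* f ≡
    a ℚ.* (c ℚ.* e ℚ.- d ℚ.* f) ℚ.- b ℚ.* (c ℚ.* f ℚ.+ d ℚ.* e)
  assoc-re = solve-∀ ℚ-ring

  assoc-im : ∀ a b c d e f →
    (a ℚ.* c ℚ.- b ℚ.* d) ℚ.* f ℚ.+ (a ℚ.* d ℚ.+ b ℚ.* c) ℚ.* e ≡
    a ℚ.* (c ℚ.* f ℚ.+ d ℚ.* e) ℚ.+ b ℚ.* (c ℚ.* e ℚ.- d ℚ.* f)
  assoc-im = solve-∀ ℚ-ring

  identity-re : ∀ a b →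
    1ℚ ℚ.* a ℚ.- 0ℚ ℚ.* b ≡
    a
  identity-re = solve-∀ ℚ-ring

  identity-im : ∀ a b →
    1ℚ ℚ.* b ℚ.+ 0ℚ ℚ.* a ≡
    b
  identity-im = solve-∀ ℚ-ring

  comm-re : ∀ a b c d →
    a ℚ.* c ℚ.- b ℚ.* d ≡
    c ℚ.* a ℚ.- d ℚ.* b
  comm-re = solve-∀ ℚ-ring

  comm-im : ∀ a b c d →
    a ℚ.* d ℚ.+ b ℚ.* c ≡
    c ℚ.* b ℚ.+ d ℚ.* a
  comm-im = solve-∀ ℚ-ring

  distrib-re : ∀ a b c d e f →
    a ℚ.* (c ℚ.+ e) ℚ.- b ℚ.* (d ℚ.+ f) ≡
    (a ℚ.* c ℚ.- b ℚ.* d) ℚ.+ (a ℚ.* e ℚ.- b ℚ.* f)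
  distrib-re = solve-∀ ℚ-ring

  distrib-im : ∀ a b c d e f →
    a ℚ.* (d ℚ.+ f) ℚ.+ b ℚ.* (c ℚ.+ e) ≡
    (a ℚ.* d ℚ.+ b ℚ.* c) ℚ.+ (a ℚ.* f ℚ.+ b ℚ.* e)
  distrib-im = solve-∀ ℚ-ring

  ≃ᶜ-isEquivalence : IsEquivalence _≃ᶜ_
  ≃ᶜ-isEquivalence = record
    { refl  = mk≃ᶜ R.refl R.refl
    ; sym   = λ (mk≃ᶜ p q) → mk≃ᶜ (R.sym p) (R.sym q)
    ; trans = λ (mk≃ᶜ p q) (mk≃ᶜ r s) → mk≃ᶜ (R.trans p r) (R.trans q s)
    }

  ≃ᶜ-setoid : Setoid 0ℓ 0ℓ
  ≃ᶜ-setoid = record { isEquivalence = ≃ᶜ-isEquivalence }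

  module ≃ᶜ-Consequences = Consequences ≃ᶜ-setoid

  +ᶜ-cong : ∀ {z z′ w w′} → z ≃ᶜ z′ → w ≃ᶜ w′ → z +ᶜ w ≃ᶜ z′ +ᶜ w′
  +ᶜ-cong (mk≃ᶜ p q) (mk≃ᶜ r s) = mk≃ᶜ (R.+-cong p r) (R.+-cong q s)

  *ᶜ-cong : ∀ {z z′ w w′} → z ≃ᶜ z′ → w ≃ᶜ w′ → z *ᶜ w ≃ᶜ z′ *ᶜ w′
  *ᶜ-cong (mk≃ᶜ p q) (mk≃ᶜ r s) = mk≃ᶜ
    (R.+-cong (R.*-cong p r) (R.-‿cong (R.*-cong q s)))
    (R.+-cong (R.*-cong p s) (R.*-cong q r))

  *ᶜ-assoc : ∀ z w v → (z *ᶜ w) *ᶜ v ≃ᶜ z *ᶜ (w *ᶜ v)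
  *ᶜ-assoc (a +i b) (c +i d) (e +i f) = mk≃ᶜ
    (pointwise λ n → assoc-re (seq a n) (seq b n) (seq c n) (seq d n) (seq e n) (seq f n))
    (pointwise λ n → assoc-im (seq a n) (seq b n) (seq c n) (seq d n) (seq e n) (seq f n))

  *ᶜ-identityˡ : ∀ z → (fromℚ 1ℚ +i fromℚ 0ℚ) *ᶜ z ≃ᶜ z
  *ᶜ-identityˡ (a +i b) = mk≃ᶜ
    (pointwise λ n → identity-re (seq a n) (seq b n))
    (pointwise λ n → identity-im (seq a n) (seq b n))

  *ᶜ-comm : ∀ z w → z *ᶜ w ≃ᶜ w *ᶜ z
  *ᶜ-comm (a +i b) (c +i d) = mk≃ᶜ
    (pointwise λ n → comm-re (seq a n) (seq b n) (seq c n) (seq d n))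
    (pointwise λ n → comm-im (seq a n) (seq b n) (seq c n) (seq d n))

  *ᶜ-distribˡ : ∀ z w v → z *ᶜ (w +ᶜ v) ≃ᶜ z *ᶜ w +ᶜ z *ᶜ v
  *ᶜ-distribˡ (a +i b) (c +i d) (e +i f) = mk≃ᶜ
    (pointwise λ n → distrib-re (seq a n) (seq b n) (seq c n) (seq d n) (seq e n) (seq f n))
    (pointwise λ n → distrib-im (seq a n) (seq b n) (seq c n) (seq d n) (seq e n) (seq f n))

ℂ-commutativeRing : CommutativeRing 0ℓ 0ℓ
ℂ-commutativeRing = record
  { Carrier = ℂ
  ; _≈_ = _≃ᶜ_
  ; _+_ = _+ᶜ_
  ; _*_ = _*ᶜ_
  ; -_  = -ᶜ_
  ; 0#  = fromℚ 0ℚ +i fromℚ 0ℚ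
  ; 1#  = fromℚ 1ℚ +i fromℚ 0ℚ
  ; isCommutativeRing = record
    { isRing = record
      { +-isAbelianGroup = record
        { isGroup = record
          { isMonoid = record
            { isSemigroup = record
              { isMagma = record
                { isEquivalence = ≃ᶜ-isEquivalence ; ∙-cong = +ᶜ-cong }
              ; assoc = λ (a +i b) (c +i d) (e +i f) →
                  mk≃ᶜ (R.+-assoc a c e) (R.+-assoc b d f)
              }
            ; identity = (λ (a +i b) → mk≃ᶜ (R.+-identityˡ a) (R.+-identityˡ b))
                       , (λ (a +i b) → mk≃ᶜ (R.+-identityʳ a) (R.+-identityʳ b))
            }
          ; inverse = (λ (a +i b) → mk≃ᶜ (R.-‿inverseˡ a) (R.-‿inverseˡ b))
                    , (λ (a +i b) → mk≃ᶜ (R.-‿inverseʳ a) (R.-‿inverseʳ b))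
          ; ⁻¹-cong = λ (mk≃ᶜ p q) → mk≃ᶜ (R.-‿cong p) (R.-‿cong q)
          }
        ; comm = λ (a +i b) (c +i d) → mk≃ᶜ (R.+-comm a c) (R.+-comm b d)
        }
      ; *-cong = *ᶜ-cong
      ; *-assoc = *ᶜ-assoc
      ; *-identity = ≃ᶜ-Consequences.comm∧idˡ⇒id *ᶜ-comm *ᶜ-identityˡ
      ; distrib = ≃ᶜ-Consequences.comm∧distrˡ⇒distr +ᶜ-cong *ᶜ-comm *ᶜ-distribˡ
      }
    ; *-comm = *ᶜ-comm
    }
  }

open CommutativeRing ℂ-commutativeRing public
  using (_≈_; _+_; _-_; _*_; -_; 1#)

open SemiringSum (CommutativeRing.semiring ℂ-commutativeRing) public
  using (sum⁺-syntax)

open SemiringExp (CommutativeRing.semiring ℂ-commutativeRing) public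
  using (_^_)

½ : ℂ
½ = fromℚ ℚ.½ +i fromℚ 0ℚ

IsGeneralizedFibonacci : (ℤ → ℂ) → Set
IsGeneralizedFibonacci G = ∀ m → G (m ℤ.+ ℤ.+ 2) ≈ G (m ℤ.+ ℤ.+ 1) + G m

{-# OPTIONS --safe #-}

-- With T n = G₀ Gₙ₊₁ − G₋₁ Gₙ, a Fibonacci sequence again,
-- the alternating self-convolution S of G satisfies
--   S (n + 2) = S (n + 1) + S n + (−1)ⁿ T (n + 1),
-- and ½ (1 + (−1)ⁿ) T n solves the same recurrence with the same initial values.
module Submission where

open import Algebra.Bundles using (CommutativeRing)
import Algebra.Properties.Ring as RingProperties
import Algebra.Properties.Semiring.Exp as SemiringExp
import Algebra.Properties.Semiring.Sum as SemiringSum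
import Algebra.Solver.Ring.NaturalCoefficients.Default as SemiringSolver
open import Data.Fin.Base using (toℕ)
import Data.Fin.Properties as Finₚ
open import Data.Integer.Base using (ℤ; +_; -[1+_]) renaming (_-_ to _-ℤ_)
import Data.Integer.Properties as ℤₚ
open import Data.Nat.Base using (ℕ; zero; suc; _≤_; _∸_)
import Data.Nat.Properties as ℕₚ
open import Function.Base using (_∘_)
open import Relation.Binary.PropositionalEquality as ≡ using (_≡_)
import Relation.Binary.Reasoning.Setoid as SetoidReasoning

module AlternatingConvolution {c ℓ} (R : CommutativeRing c ℓ) where
  open CommutativeRing R
    using ( Carrier; _≈_; _+_; _*_; -_; _-_; 0#; 1#; setoid; refl; sym; trans
          ; ring; semiring; commutativeSemiring
          ; +-cong; +-congˡ; +-congʳ; +-identityʳ; -‿inverseʳ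
          ; *-cong; *-congˡ; *-congʳ; *-assoc; *-comm; *-identityˡ)
  open RingProperties ring using (-1*x≈-x; -‿involutive)
  open SemiringExp semiring using (_^_)
  open SemiringSum semiring using (sum⁺-syntax; sum-cong-≋; *-distribˡ-sum)
  open SetoidReasoning setoid

  -- The solver knows no negation, so all signs are factors -1#, opaque to it.
  open SemiringSolver commutativeSemiring using (solve; con; _:=_; _:+_; _:*_)

  -1# : Carrier
  -1# = - 1#

  -1*-1*y≈y : ∀ y → -1# * -1# * y ≈ y
  -1*-1*y≈y y = trans
    (*-congʳ (trans (-1*x≈-x -1#) (-‿involutive 1#))) (*-identityˡ y)

  y+-1*y≈0 : ∀ y → y + -1# * y ≈ 0#
  y+-1*y≈0 y = trans (+-congˡ (-1*x≈-x y)) (-‿inverseʳ y)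

  IsFibonacci : (ℕ → Carrier) → Set ℓ
  IsFibonacci g = ∀ n → g (suc (suc n)) ≈ g (suc n) + g n

  -- Two separate sequences, although only `altConv g g` is wanted: the inductions below shift `f`
  -- and keep `g` fixed, which a self-convolution would not allow.
  altConv : (ℕ → Carrier) → (ℕ → Carrier) → ℕ → Carrier
  altConv f g n = ∑[ k ≤ n ] (-1# ^ toℕ k * f (toℕ k) * g (n ∸ toℕ k))

  altConv-zero : ∀ f g → altConv f g 0 ≈ f 0 * g 0
  altConv-zero f g = trans (+-identityʳ _) (*-congʳ (*-identityˡ (f 0)))

  -- The term at index 0 splits off; in the rest, moving the index by one costs a factor `-1#` and
  -- turns `f` into `f ∘ suc`, while `suc n ∸ suc k` computes to `n ∸ k`.
  altConv-suc : ∀ f g n →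
    altConv f g (suc n) ≈ f 0 * g (suc n) + -1# * altConv (f ∘ suc) g n
  altConv-suc f g n = +-cong (*-congʳ (*-identityˡ (f 0))) (trans
    (sum-cong-≋ {suc n} λ k →
      solve 4 (λ e p a b → e :* p :* a :* b := e :* (p :* a :* b))
        refl -1# (-1# ^ toℕ k) (f (suc (toℕ k))) (g (n ∸ toℕ k)))
    (sym (*-distribˡ-sum {suc n} -1#
      (λ k → -1# ^ toℕ k * f (suc (toℕ k)) * g (n ∸ toℕ k)))))

  -- Here x plays the role of the term g₋₁ preceding g₀.
  altConv-recurrence : ∀ f g x → IsFibonacci g → g 1 ≈ g 0 + x → ∀ n →
    altConv f g (suc (suc n)) ≈
    altConv f g (suc n) + altConv f g n +
    -1# ^ n * (g 0 * f (suc (suc n)) + -1# * x * f (suc n))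
  altConv-recurrence f g x fib g₁ zero = begin
    altConv f g 2
      ≈⟨ altConv-suc f g 1 ⟩
    f 0 * g 2 + -1# * altConv (f ∘ suc) g 1
      -- Only the `g 1` multiplying `f 1` becomes `g 0 + x`; the one coming from `g 2` stays, to
      -- form `altConv f g 1`.
      ≈⟨ +-cong (*-congˡ (fib 0)) (*-congˡ (trans (altConv-suc (f ∘ suc) g 0)
           (+-cong (*-congˡ g₁) (*-congˡ (altConv-zero (f ∘ suc ∘ suc) g))))) ⟩
    f 0 * (g 1 + g 0) + -1# * (f 1 * (g 0 + x) + -1# * (f 2 * g 0))
      ≈⟨ solve 7 (λ e f₀ f₁ f₂ g₀ g₁ x →
           f₀ :* (g₁ :+ g₀) :+ e :* (f₁ :* (g₀ :+ x) :+ e :* (f₂ :* g₀)) :=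
           f₀ :* g₁ :+ e :* (f₁ :* g₀) :+ f₀ :* g₀ :+ (e :* e :* (g₀ :* f₂) :+ e :* x :* f₁))
           refl -1# (f 0) (f 1) (f 2) (g 0) (g 1) x ⟩
    f 0 * g 1 + -1# * (f 1 * g 0) + f 0 * g 0 +
      (-1# * -1# * (g 0 * f 2) + -1# * x * f 1)
      ≈⟨ +-cong (+-cong (trans (+-congˡ (*-congˡ (sym (altConv-zero (f ∘ suc) g))))
                               (sym (altConv-suc f g 0)))
                        (sym (altConv-zero f g)))
           (trans (+-congʳ (-1*-1*y≈y _)) (sym (*-identityˡ _))) ⟩
    altConv f g 1 + altConv f g 0 + 1# * (g 0 * f 2 + -1# * x * f 1) ∎
  altConv-recurrence f g x fib g₁ (suc n) = begin
    altConv f g (suc (suc (suc n)))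
      ≈⟨ altConv-suc f g (suc (suc n)) ⟩
    f 0 * g (suc (suc (suc n))) + -1# * altConv f′ g (suc (suc n))
      -- The hypothesis is applied to the shifted `f′`, so its boundary term `t` is already the one
      -- required for `f` at `suc n`; the outer `-1#` supplies the missing power.
      ≈⟨ +-cong (*-congˡ (fib (suc n)))
                (*-congˡ (altConv-recurrence f′ g x fib g₁ n)) ⟩
    f 0 * (g (suc (suc n)) + g (suc n)) +
      -1# * (altConv f′ g (suc n) + altConv f′ g n + -1# ^ n * t)
      ≈⟨ solve 8 (λ e p f₀ g₁ g₂ s₀ s₁ t →
           f₀ :* (g₂ :+ g₁) :+ e :* (s₁ :+ s₀ :+ p :* t) :=
           f₀ :* g₂ :+ e :* s₁ :+ (f₀ :* g₁ :+ e :* s₀) :+ e :* p :* t)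
           refl -1# (-1# ^ n) (f 0) (g (suc n)) (g (suc (suc n)))
           (altConv f′ g n) (altConv f′ g (suc n)) t ⟩
    f 0 * g (suc (suc n)) + -1# * altConv f′ g (suc n) +
      (f 0 * g (suc n) + -1# * altConv f′ g n) + -1# * -1# ^ n * t
      ≈⟨ +-congʳ (+-cong (altConv-suc f g (suc n)) (altConv-suc f g n)) ⟨
    altConv f g (suc (suc n)) + altConv f g (suc n) + -1# ^ suc n * t ∎
    where
    f′ : ℕ → Carrier
    f′ = f ∘ suc
    t : Carrier
    t = g 0 * f′ (suc (suc n)) + -1# * x * f′ (suc n)

  module SelfConvolution
    {½ : Carrier} (½+½≈1 : ½ + ½ ≈ 1#)
    {g : ℕ → Carrier} (fib : IsFibonacci g)
    {x : Carrier} (g₁ : g 1 ≈ g 0 + x)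
    where

    private
      T : ℕ → Carrier
      T n = g 0 * g (suc n) + -1# * x * g n

    -- `T` combines `g` and its shift with coefficients independent of `n`, and the recurrence is
    -- linear.
    T-fibonacci : IsFibonacci T
    T-fibonacci n = trans
      (+-cong (*-congˡ (fib (suc n))) (*-congˡ (fib n)))
      (solve 5 (λ a b g₀ g₁ g₂ →
        a :* (g₂ :+ g₁) :+ b :* (g₁ :+ g₀) :=
        a :* g₂ :+ b :* g₁ :+ (a :* g₁ :+ b :* g₀))
        refl (g 0) (-1# * x) (g n) (g (suc n)) (g (suc (suc n))))

    altConv≈½[1+-1^n]T : ∀ n → altConv g g n ≈ ½ * (1# + -1# ^ n) * T n
    altConv≈½[1+-1^n]T zero = begin
      altConv g g 0
        ≈⟨ altConv-zero g g ⟩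
      g 0 * g 0
        -- A cancelling pair is inserted so that `g 0 + x`, hence `g 1`, can be factored out.
        ≈⟨ trans (+-congˡ (y+-1*y≈0 (x * g 0))) (+-identityʳ _) ⟨
      g 0 * g 0 + (x * g 0 + -1# * (x * g 0))
        ≈⟨ solve 3 (λ e a x →
             a :* a :+ (x :* a :+ e :* (x :* a)) :=
             a :* (a :+ x) :+ e :* x :* a)
             refl -1# (g 0) x ⟩
      g 0 * (g 0 + x) + -1# * x * g 0
        ≈⟨ +-congʳ (*-congˡ g₁) ⟨
      T 0
        ≈⟨ trans (*-congʳ ½+½≈1) (*-identityˡ (T 0)) ⟨
      (½ + ½) * T 0
        ≈⟨ solve 2 (λ h t → (h :+ h) :* t := h :* (con 1 :+ con 1) :* t)
             refl ½ (T 0) ⟩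
      ½ * (1# + 1#) * T 0 ∎
    altConv≈½[1+-1^n]T (suc zero) = begin
      altConv g g 1
        ≈⟨ altConv-suc g g 0 ⟩
      g 0 * g 1 + -1# * altConv (g ∘ suc) g 0
        ≈⟨ +-congˡ (*-congˡ (trans (altConv-zero (g ∘ suc) g) (*-comm (g 1) (g 0)))) ⟩
      g 0 * g 1 + -1# * (g 0 * g 1)
        ≈⟨ y+-1*y≈0 (g 0 * g 1) ⟩
      0#
        -- At index 1 both sides vanish, the right one because its parity factor is zero.
        ≈⟨ y+-1*y≈0 (½ * T 1) ⟨
      ½ * T 1 + -1# * (½ * T 1)
        ≈⟨ solve 3 (λ e h t →
             h :* t :+ e :* (h :* t) :=
             h :* (con 1 :+ e :* con 1) :* t)
             refl -1# ½ (T 1) ⟩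
      ½ * (1# + -1# * 1#) * T 1 ∎
    altConv≈½[1+-1^n]T (suc (suc n)) = begin
      altConv g g (suc (suc n))
        ≈⟨ altConv-recurrence g g x fib g₁ n ⟩
      altConv g g (suc n) + altConv g g n + p * T (suc n)
        ≈⟨ +-cong (+-cong (altConv≈½[1+-1^n]T (suc n)) (altConv≈½[1+-1^n]T n))
             -- Halving the boundary term lets one half cancel the negative term from `1# + -1# * p`
             -- and the other turn that factor into `1# + p`.
             (sym (trans (*-congʳ ½+½≈1) (*-identityˡ _))) ⟩
      ½ * (1# + -1# * p) * T (suc n) + ½ * (1# + p) * T n + (½ + ½) * (p * T (suc n))
        ≈⟨ solve 5 (λ e p h t₀ t₁ →
             h :* (con 1 :+ e :* p) :* t₁ :+ h :* (con 1 :+ p) :* t₀ :+ (h :+ h) :* (p :* t₁) :=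
             h :* (con 1 :+ p) :* (t₁ :+ t₀) :+ (h :* (p :* t₁) :+ e :* (h :* (p :* t₁))))
             refl -1# p ½ (T n) (T (suc n)) ⟩
      ½ * (1# + p) * (T (suc n) + T n) + (½ * (p * T (suc n)) + -1# * (½ * (p * T (suc n))))
        ≈⟨ trans (+-congˡ (y+-1*y≈0 _)) (+-identityʳ _) ⟩
      ½ * (1# + p) * (T (suc n) + T n)
        ≈⟨ *-cong (*-congˡ (+-congˡ (trans (sym (*-assoc -1# -1# p)) (-1*-1*y≈y p)))) (T-fibonacci n) ⟨
      ½ * (1# + -1# ^ suc (suc n)) * T (suc (suc n)) ∎
      where
      p : Carrier
      p = -1# ^ n

    altConv-self : ∀ n →
      altConv g g n ≈ - ½ * (1# + -1# ^ n) * (x * g n - g 0 * g (suc n))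
    altConv-self n = begin
      altConv g g n
        ≈⟨ altConv≈½[1+-1^n]T n ⟩
      ½ * (1# + -1# ^ n) * T n
        -- `T n` is the negative of the target bracket; of the two signs created here, one stays
        -- inside and one goes to `½`.
        ≈⟨ *-congˡ (+-congʳ (-1*-1*y≈y _)) ⟨
      ½ * (1# + -1# ^ n) * (-1# * -1# * (g 0 * g (suc n)) + -1# * x * g n)
        ≈⟨ solve 6 (λ e h p x y z →
             h :* p :* (e :* e :* z :+ e :* x :* y) :=
             e :* h :* p :* (x :* y :+ e :* z))
             refl -1# ½ (1# + -1# ^ n) x (g n) (g 0 * g (suc n)) ⟩
      -1# * ½ * (1# + -1# ^ n) * (x * g n + -1# * (g 0 * g (suc n)))
        ≈⟨ *-cong (*-congʳ (-1*x≈-x ½)) (+-congˡ (-1*x≈-x _)) ⟩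
      - ½ * (1# + -1# ^ n) * (x * g n - g 0 * g (suc n)) ∎

open import Defs

mainTheorem12 : (G : ℤ → ℂ) → IsGeneralizedFibonacci G → (n : ℕ) →
    ∑[ k ≤ n ] ((- 1#) ^ toℕ k * G (+ toℕ k) * G (+ n -ℤ + toℕ k))
    ≈ - ½ * (1# + (- 1#) ^ n) * (G -[1+ 0 ] * G (+ n) - G (+ 0) * G (+ suc n))
mainTheorem12 G fib n = ℂ-ring.trans
  -- Since `k` ranges over at most `n`, the integer difference agrees with truncated subtraction.
  (sum-cong-≋ {suc n} λ k → ℂ-ring.reflexive (≡.cong (λ i → (- 1#) ^ toℕ k * G (+ toℕ k) * G i)
    (+m-+n≡+[m∸n] (Finₚ.toℕ≤pred[n] k))))
  -- The recurrence at index -1 reads `G (+ 1) ≈ G (+ 0) + G -[1+ 0 ]`, which fixes `x` as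
  -- `G -[1+ 0 ]`.
  (altConv-self ½+½≈1 fib⁺ (fib -[1+ 0 ]) n)
  where
  module ℂ-ring = CommutativeRing ℂ-commutativeRing
  open SemiringSum ℂ-ring.semiring using (sum-cong-≋)
  open AlternatingConvolution ℂ-commutativeRing using (IsFibonacci; module SelfConvolution)
  open SelfConvolution using (altConv-self)
  +m-+n≡+[m∸n] : ∀ {m n} → n ≤ m → + m -ℤ + n ≡ + (m ∸ n)
  +m-+n≡+[m∸n] {m} {n} n≤m = ≡.trans (ℤₚ.m-n≡m⊖n m n) (ℤₚ.⊖-≥ n≤m)
  ½+½≈1 : ½ + ½ ≈ 1#
  ½+½≈1 = mk≃ᶜ (pointwise λ _ → ≡.refl) (pointwise λ _ → ≡.refl)
  fib⁺ : IsFibonacci (G ∘ +_)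
  fib⁺ m = ≡.subst₂ (λ i j → G (+ i) ≈ G (+ j) + G (+ m))
    (ℕₚ.+-comm m 2) (ℕₚ.+-comm m 1) (fib (+ m))
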